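{- Closed branching does not satisfy the identity law. That is, there is no connected computon $\lambda$ such that, for every connected computon $\lambda_3$ (in the same computon category), $\lambda??_{\rho}\lambda_3\cong\lambda_3$ for every b-diagram $\rho$ given by spans $\lambda\xleftarrow{\lambda^+}\lambda_0\xrightarrow{\lambda_3^+}\lambda_3$ and $\lambda\xleftarrow{\lambda^- }\lambda_1\xrightarrow{\lambda_3^- }\lambda_3$, and $\lambda_3??_{\rho'}\lambda\cong\lambda_3$ for every b-diagram $\rho'$ given by spans $\lambda_3\xleftarrow{\lambda_3^+}\lambda_0\xrightarrow{\lambda^+}\lambda$ and $\lambda_3\xleftarrow{\lambda_3^- }\lambda_1\xrightarrow{\lambda^- }\lambda$.
   Context: Fix $n\ge 1$, the set of types $\underline{n}:=\{0,1,\dots,n-1\}$ (type $0$ is the control type), and a finite nonempty set $B\subset\Sigma^*$ of computing devices over a finite alphabet $\Sigma$, with a distinguished element $\epsilon\in B$. All computons are over these fixed $\underline{n}$ and $B$. **Computon.** A computon $\lambda$ is a tuple $(U,P,I,O,\underline{n},B,\sigma,t,\tau,s,c,r,f)$ where $U$ (computation units), $I$ (inflows), $O$ (outflows) are finite sets, $P$ (ports) is a finite nonempty set, $\sigma\colon O\to U$, $\tau\colon I\to U$ and $r\colon I\to O$ are surjective functions, and $t\colon O\to P$, $s\colon I\to P$, $c\colon P\to\underline{n}$, $f\colon O\to B$ are functions, such that: the restrictions of $\tau$ to $(c\circ s)^{ -1}(0)$ and of $\sigma$ to $(c\circ t)^{ -1}(0)$ are surjective onto $U$; $\sigma\circ r=\tau$;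 and there exist $p\in P\setminus t(O)$ and $q\in P\setminus s(I)$ with $c(p)=0=c(q)$. Components of a computon $\lambda_k$ carry the index $k$. Write $P^+:=P\setminus t(O)$ (inports), $P^-:=P\setminus s(I)$ (outports), and for $p\in P$ write $p\bullet:=\tau(s^{ -1}(p))$ and $\bullet p:=\sigma(t^{ -1}(p))$. **Connected computon.** The bipartite graph of $\lambda$ is the directed graph $G$ with vertex set $U\sqcup P$, edge set $I\sqcup O$, source map $s'$ given by $s'(e)=s(e)$ for $e\in I$ and $s'(e)=\sigma(e)$ for $e\in O$, and target map $t'$ given by $t'(e)=\tau(e)$ for $e\in I$ and $t'(e)=t(e)$ for $e\in O$. The computon $\lambda$ is connected if for every port $p\in P^+\cup s(I)$ there is a (directed) path $(e_1,\dots,e_m)$ in $G$ of length $m\ge 2$ with $s'(e_1)=p$ and $t'(e_m)\in P^-$. **Morphism.** A computon morphism $\alpha\colon\lambda_1\to\lambda_2$ consists of functions $\alpha_U\colon U_1\to U_2$, $\alpha_P\colon P_1\to P_2$, $\alpha_I\colon I_1\to I_2$, $\alpha_O\colon O_1\to O_2$ and the inclusions (identities) on $\underline{n}$ and on $B$, such that $\alpha_U\tau_1=\tau_2\alpha_I$, $\alpha_U\sigma_1=\sigma_2\alpha_O$, $\alpha_P s_1=s_2\alpha_I$, $\alpha_P t_1=t_2\alpha_O$, $\alpha_O r_1=r_2\alpha_I$, $f_2\alpha_O=f_1$, $c_2\alpha_P=c_1$, and $\vec{i}(\alpha)\cup\vec{o}(\alpha)\subseteq P_1^+\cup P_1^-$,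 where $\vec{i}(\alpha)=\{p\in P_1\mid \bullet\alpha_P(p)\setminus\alpha_U(\bullet p)\ne\emptyset\}$ and $\vec{o}(\alpha)=\{p\in P_1\mid \alpha_P(p)\bullet\setminus\alpha_U(p\bullet)\neq\emptyset\}$. Morphisms compose componentwise; a monomorphism is a morphism all of whose components are injective; isomorphism $\cong$ means isomorphism in this category. **Markers.** A computon is trivial if $U=I=O=\emptyset$. An in-marker $\lambda^+$ (respectively out-marker $\lambda^-$) of a computon $\lambda$ is a computon monomorphism $\lambda_0\to\lambda$ where $\lambda_0$ is a trivial computon and the image of $P_0$ is $P^+$ (respectively $P^-$). **Coproduct and pushout.** The coproduct $\lambda_1+\lambda_2$ and the pushout $\lambda_1+_{\lambda_0}\lambda_2$ of a span $\lambda_1\leftarrow\lambda_0\to\lambda_2$ are formed componentwise: the sets of units, ports, inflows and outflows are the disjoint unions (respectively the pushouts of finite sets, e.g. $U_1\sqcup_{U_0}U_2$), with the induced structure functions (over the same $\underline{n}$ and $B$). **Closed branching.** A b-diagram $\rho$ is a pair of spans $\lambda_2\xleftarrow{\lambda_2^+}\lambda_0\xrightarrow{\lambda_3^+}\lambda_3$ (of in-markers) and $\lambda_2\xleftarrow{\lambda_2^- }\lambda_1\xrightarrow{\lambda_3^- }\lambda_3$ (of out-markers), where $\lambda_2$ and $\lambda_3$ are connected computons. The closed branching computon $\lambda_2??_\rho\lambda_3$ is the colimit of $\rho$, computed as the pushout $\lambda_2+_{\lambda_0+\lambda_1}\lambda_3$ of the span $\lambda_2\leftarrow\lambda_0+\lambda_1\to\lambda_3$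 whose legs are the copairings of $\lambda_2^+,\lambda_2^-$ and of $\lambda_3^+,\lambda_3^-$. -}

module Defs where

open import Data.Bool using (Bool; true; false)
open import Data.Empty using (⊥-elim)
open import Data.Fin using (Fin; zero; suc; toℕ; punchIn; punchOut)
open import Data.Fin.Properties using (any?; +↔⊎; punchIn-punchOut; punchInᵢ≢i; punchIn-injective)
  renaming (_≟_ to _≟ᶠ_)
open import Data.List using (List)
open import Data.List.Membership.Propositional using () renaming (_∈_ to _∈ˡ_)
open import Data.Nat using (ℕ; zero; suc; _+_; _≤_)
open import Data.Product using (∃; _×_; _,_; proj₁)
open import Data.Sum using (_⊎_; inj₁; inj₂; [_,_]; [_,_]′)
import Data.Sum as Sum
open import Data.Sum.Function.Propositional using (_⊎-↔_)
open import Data.Sum.Properties using (inj₁-injective; inj₂-injective)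
open import Function using (_∘_; id; _↔_; Inverse; mk↔ₛ′)
open import Function.Definitions using (Injective)
open import Function.Construct.Composition using (_↔-∘_)
open import Function.Construct.Identity using (↔-id)
open import Function.Construct.Symmetry using (↔-sym)
open import Level using (0ℓ)
open import Relation.Binary.Definitions using (DecidableEquality)
open import Relation.Binary.PropositionalEquality
  using (_≡_; _≢_; _≗_; refl; sym; trans; cong; subst)
open import Relation.Nullary using (¬_; Dec; yes; no; does)
open import Relation.Nullary.Decidable using (map′; dec-true; dec-false; ¬?)
open import Relation.Unary using (Pred; _∈_; _∉_; _⊆_; _≐_; _∪_; _∖_; _⊢_; Satisfiable; ∁)

private variable
  A B C : Set

Finite : Set → Set
Finite A = ∃ λ k → A ↔ Fin k

finite-⊎ : Finite A → Finite B → Finite (A ⊎ B)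
finite-⊎ (m , α) (n , β) = m + n , ↔-sym +↔⊎ ↔-∘ (α ⊎-↔ β)

finite-≟ : Finite A → DecidableEquality A
finite-≟ (_ , α) x y = map′
  (λ eq → trans (sym (α.strictlyInverseʳ x)) (trans (cong α.from eq) (α.strictlyInverseʳ y)))
  (cong α.to) (α.to x ≟ᶠ α.to y)
  where module α = Inverse α

finite-∃? : {Q : Pred A 0ℓ} → Finite A → (∀ x → Dec (Q x)) → Dec (∃ Q)
finite-∃? {Q = Q} (_ , α) Q? = map′
  (λ (i , q) → α.from i , q)
  (λ (x , q) → α.to x , subst Q (sym (α.strictlyInverseʳ x)) q)
  (any? (Q? ∘ α.from))
  where module α = Inverse α

image : (A → B) → Pred A 0ℓ → Pred B 0ℓ
image g S b = ∃ λ a → a ∈ S × g a ≡ b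

range : (A → B) → Pred B 0ℓ
range g b = ∃ λ a → g a ≡ b

-- class-surjective gives the uniqueness of lift.
record Coequaliser {A X : Set} (l r : A → X) : Set₁ where
  field
    Carrier          : Set
    finite           : Finite Carrier
    class            : X → Carrier
    class-glues      : ∀ a → class (l a) ≡ class (r a)
    class-surjective : ∀ q → q ∈ range class
    lift             : {D : Set} (h : X → D) → (∀ a → h (l a) ≡ h (r a)) → Carrier → D
    lift-class       : {D : Set} (h : X → D) (e : ∀ a → h (l a) ≡ h (r a)) →
                       ∀ x → lift h e (class x) ≡ h x

module _ {k : ℕ} {x y : Fin (suc k)} (y≢x : y ≢ x) where

  private
    collapse : Fin (suc k) → Fin k
    collapse z with y ≟ᶠ z
    ... | yes _   = punchOut y≢x
    ... | no  y≢z = punchOut y≢z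

    collapse-y : collapse y ≡ punchOut y≢x
    collapse-y with y ≟ᶠ y
    ... | yes _   = refl
    ... | no  y≢y = ⊥-elim (y≢y refl)

    collapse-≢ : ∀ {z} (y≢z : y ≢ z) → punchIn y (collapse z) ≡ z
    collapse-≢ {z} y≢z with y ≟ᶠ z
    ... | yes y≡z = ⊥-elim (y≢z y≡z)
    ... | no  q   = punchIn-punchOut q

    h-collapse : {D : Set} (h : Fin (suc k) → D) → h x ≡ h y →
                 ∀ z → h (punchIn y (collapse z)) ≡ h z
    h-collapse h e z with y ≟ᶠ z
    ... | yes refl = trans (cong h (punchIn-punchOut y≢x)) e
    ... | no  q    = cong h (punchIn-punchOut q)

    punchIn-inj : ∀ {i j : Fin k} → punchIn y i ≡ punchIn y j → i ≡ j
    punchIn-inj = punchIn-injective y _ _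

    collapse-x : collapse x ≡ punchOut y≢x
    collapse-x = punchIn-inj (trans (collapse-≢ y≢x) (sym (punchIn-punchOut y≢x)))

  glue-distinct : Coequaliser {Fin 1} (λ _ → x) (λ _ → y)
  glue-distinct = record
    { Carrier          = Fin k
    ; finite           = k , ↔-id _
    ; class            = collapse
    ; class-glues      = λ _ → trans collapse-x (sym collapse-y)
    ; class-surjective = λ w → punchIn y w
                             , punchIn-inj (collapse-≢ (punchInᵢ≢i y w ∘ sym))
    ; lift             = λ h _ → h ∘ punchIn y
    ; lift-class       = λ h e → h-collapse h (e zero)
    }

glue-pair : ∀ {k} (x y : Fin k) → Coequaliser {Fin 1} (λ _ → x) (λ _ → y)
glue-pair {suc k} x y with y ≟ᶠ x
... | no  y≢x  = glue-distinct y≢x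
... | yes refl = record
  { Carrier = Fin (suc k) ; finite = suc k , ↔-id _ ; class = id ; class-glues = λ _ → refl
  ; class-surjective = λ q → q , refl ; lift = λ h _ → h ; lift-class = λ _ _ _ → refl }

coequaliser-Fin : ∀ m {X : Set} → Finite X → (l r : Fin m → X) → Coequaliser l r
coequaliser-Fin zero {X} fin l r = record
  { Carrier = X ; finite = fin ; class = id ; class-glues = λ ()
  ; class-surjective = λ q → q , refl ; lift = λ h _ → h ; lift-class = λ _ _ _ → refl }
coequaliser-Fin (suc m) {X} (k , α) l r = record
  { Carrier          = T.Carrier
  ; finite           = T.finite
  ; class            = T.class ∘ step
  ; class-glues      = λ { zero → cong T.class (H.class-glues zero) ; (suc i) → T.class-glues i }
  ; class-surjective = surj
  ; lift             = λ h e → T.lift (hd h e) (tl h e)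
  ; lift-class       = λ h e x → trans (T.lift-class (hd h e) (tl h e) (step x)) (hd-step h e x)
  }
  where
  module α = Inverse α
  module H = Coequaliser (glue-pair (α.to (l zero)) (α.to (r zero)))
  step : X → H.Carrier
  step = H.class ∘ α.to
  module T = Coequaliser (coequaliser-Fin m H.finite (step ∘ l ∘ suc) (step ∘ r ∘ suc))

  surj : ∀ q → q ∈ range (T.class ∘ step)
  surj q with T.class-surjective q
  ... | w , refl with H.class-surjective w
  ... | i , refl = α.from i , cong (T.class ∘ H.class) (α.strictlyInverseˡ i)

  module _ {D : Set} (h : X → D) (e : ∀ a → h (l a) ≡ h (r a)) where
    from-to : ∀ x → h (α.from (α.to x)) ≡ h x
    from-to x = cong h (α.strictlyInverseʳ x)

    head-eq : Fin 1 → h (α.from (α.to (l zero))) ≡ h (α.from (α.to (r zero)))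
    head-eq _ = trans (from-to _) (trans (e zero) (sym (from-to _)))

    hd : H.Carrier → D
    hd = H.lift (h ∘ α.from) head-eq

    hd-step : ∀ x → hd (step x) ≡ h x
    hd-step x = trans (H.lift-class (h ∘ α.from) head-eq (α.to x)) (from-to x)

    tl : ∀ i → hd (step (l (suc i))) ≡ hd (step (r (suc i)))
    tl i = trans (hd-step _) (trans (e (suc i)) (sym (hd-step _)))

-- cover gives the uniqueness of copair.
record Pushout {A B C : Set} (g₁ : A → B) (g₂ : A → C) : Set₁ where
  field
    Carrier    : Set
    finite     : Finite Carrier
    inl        : B → Carrier
    inr        : C → Carrier
    commutes   : ∀ a → inl (g₁ a) ≡ inr (g₂ a)
    cover      : ∀ q → q ∈ range inl ⊎ q ∈ range inr
    copair     : {D : Set} (h : B → D) (k : C → D) →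
                 (∀ a → h (g₁ a) ≡ k (g₂ a)) → Carrier → D
    copair-inl : {D : Set} (h : B → D) (k : C → D) (e : ∀ a → h (g₁ a) ≡ k (g₂ a)) →
                 ∀ b → copair h k e (inl b) ≡ h b
    copair-inr : {D : Set} (h : B → D) (k : C → D) (e : ∀ a → h (g₁ a) ≡ k (g₂ a)) →
                 ∀ c → copair h k e (inr c) ≡ k c

opaque
  pushout : Finite A → Finite B → Finite C → (g₁ : A → B) (g₂ : A → C) → Pushout g₁ g₂
  pushout {A} {B} {C} (m , α) finB finC g₁ g₂ = record
    { Carrier    = Q.Carrier
    ; finite     = Q.finite
    ; inl        = Q.class ∘ inj₁
    ; inr        = Q.class ∘ inj₂
    ; commutes   = λ a → subst (λ a → Q.class (inj₁ (g₁ a)) ≡ Q.class (inj₂ (g₂ a)))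
                               (α.strictlyInverseʳ a) (Q.class-glues (α.to a))
    ; cover      = cov
    ; copair     = λ h k e → Q.lift [ h , k ]′ (e ∘ α.from)
    ; copair-inl = λ h k e b → Q.lift-class [ h , k ]′ (e ∘ α.from) (inj₁ b)
    ; copair-inr = λ h k e c → Q.lift-class [ h , k ]′ (e ∘ α.from) (inj₂ c)
    }
    where
    module α = Inverse α
    module Q = Coequaliser (coequaliser-Fin m (finite-⊎ finB finC)
                              (inj₁ ∘ g₁ ∘ α.from) (inj₂ ∘ g₂ ∘ α.from))
    cov : ∀ q → q ∈ range (Q.class ∘ inj₁) ⊎ q ∈ range (Q.class ∘ inj₂)
    cov q with Q.class-surjective q
    ... | inj₁ b , eq = inj₁ (b , eq)
    ... | inj₂ c , eq = inj₂ (c , eq)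

-- n is the number of types, type 0 being the control type; 𝓑 lists the devices, as words over 𝓐.
module Computons (n : ℕ) {𝓐 : Set} (𝓑 : List (List 𝓐)) where

  record RawComputon : Set₁ where
    field
      U P I O  : Set
      U-finite : Finite U
      P-finite : Finite P
      I-finite : Finite I
      O-finite : Finite O
      σ : O → U
      t : O → P
      τ : I → U
      s : I → P
      c : P → Fin n
      r : I → O
      f : O → List 𝓐

    Control : Pred P 0ℓ
    Control p = toℕ (c p) ≡ 0

    P⁺ P⁻ : Pred P 0ℓ
    P⁺ = ∁ (range t)
    P⁻ = ∁ (range s)

    _• : P → Pred U 0ℓ
    p • = image τ (λ i → s i ≡ p)

    •_ : P → Pred U 0ℓ
    • p = image σ (λ o → t o ≡ p)

  record IsComputon (L : RawComputon) : Set where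
    open RawComputon L
    field
      P-nonempty           : P
      f∈𝓑                  : ∀ o → f o ∈ˡ 𝓑
      σ-surjective         : ∀ u → u ∈ range σ
      τ-surjective         : ∀ u → u ∈ range τ
      r-surjective         : ∀ o → o ∈ range r
      τ-control-surjective : ∀ u → u ∈ image τ (λ i → s i ∈ Control)
      σ-control-surjective : ∀ u → u ∈ image σ (λ o → t o ∈ Control)
      σ∘r≗τ                : σ ∘ r ≗ τ
      control-inport       : ∃ λ p → p ∈ P⁺ × p ∈ Control
      control-outport      : ∃ λ q → q ∈ P⁻ × q ∈ Control

  record Computon : Set₁ where
    field
      raw        : RawComputon
      isComputon : IsComputon raw
    open RawComputon raw public
    open IsComputon isComputon public

  module Graph (L : Computon) where
    open Computon L

    Vertex Edge : Set
    Vertex = U ⊎ P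
    Edge   = I ⊎ O

    source target : Edge → Vertex
    source = [ inj₂ ∘ s , inj₁ ∘ σ ]′
    target = [ inj₁ ∘ τ , inj₂ ∘ t ]′

    data Path : Vertex → Vertex → ℕ → Set where
      []  : ∀ {v} → Path v v 0
      _∷_ : ∀ {w m} (e : Edge) → Path (target e) w m → Path (source e) w (suc m)

  Connected : Computon → Set
  Connected L = ∀ p → p ∈ P⁺ ∪ range s →
    ∃ λ q → ∃ λ m → q ∈ P⁻ × 2 ≤ m × Path (inj₂ p) (inj₂ q) m
    where
    open Computon L
    open Graph L

  record Morphism (L₁ L₂ : Computon) : Set where
    private
      module L₁ = Computon L₁
      module L₂ = Computon L₂
    field
      mapU : L₁.U → L₂.U
      mapP : L₁.P → L₂.P
      mapI : L₁.I → L₂.I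
      mapO : L₁.O → L₂.O
      map-τ : mapU ∘ L₁.τ ≗ L₂.τ ∘ mapI
      map-σ : mapU ∘ L₁.σ ≗ L₂.σ ∘ mapO
      map-s : mapP ∘ L₁.s ≗ L₂.s ∘ mapI
      map-t : mapP ∘ L₁.t ≗ L₂.t ∘ mapO
      map-r : mapO ∘ L₁.r ≗ L₂.r ∘ mapI
      map-f : L₂.f ∘ mapO ≗ L₁.f
      map-c : L₂.c ∘ mapP ≗ L₁.c

    i⃗ : Pred L₁.P 0ℓ
    i⃗ p = Satisfiable ((L₂.• mapP p) ∖ image mapU (L₁.• p))

    o⃗ : Pred L₁.P 0ℓ
    o⃗ p = Satisfiable ((mapP p L₂.•) ∖ image mapU (p L₁.•))

    field
      boundary : i⃗ ∪ o⃗ ⊆ L₁.P⁺ ∪ L₁.P⁻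

  IsMono : ∀ {L₁ L₂} → Morphism L₁ L₂ → Set
  IsMono α = Injective _≡_ _≡_ mapU × Injective _≡_ _≡_ mapP
           × Injective _≡_ _≡_ mapI × Injective _≡_ _≡_ mapO
    where open Morphism α

  infix 4 _≅_
  record _≅_ (L₁ L₂ : Computon) : Set where
    field
      to   : Morphism L₁ L₂
      from : Morphism L₂ L₁
    private
      module to   = Morphism to
      module from = Morphism from
    field
      from∘to-U : from.mapU ∘ to.mapU ≗ id
      from∘to-P : from.mapP ∘ to.mapP ≗ id
      from∘to-I : from.mapI ∘ to.mapI ≗ id
      from∘to-O : from.mapO ∘ to.mapO ≗ id
      to∘from-U : to.mapU ∘ from.mapU ≗ id
      to∘from-P : to.mapP ∘ from.mapP ≗ id
      to∘from-I : to.mapI ∘ from.mapI ≗ id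
      to∘from-O : to.mapO ∘ from.mapO ≗ id

  Trivial : Computon → Set
  Trivial L = ¬ U × ¬ I × ¬ O
    where open Computon L

  record InMarker (L₀ L : Computon) : Set where
    field
      trivial  : Trivial L₀
      morphism : Morphism L₀ L
      mono     : IsMono morphism
    open Morphism morphism public
    field
      image-P  : range mapP ≐ Computon.P⁺ L

  record OutMarker (L₀ L : Computon) : Set where
    field
      trivial  : Trivial L₀
      morphism : Morphism L₀ L
      mono     : IsMono morphism
    open Morphism morphism public
    field
      image-P  : range mapP ≐ Computon.P⁻ L

  module _ (L₁ L₂ : Computon) where
    private
      module L₁ = Computon L₁
      module L₂ = Computon L₂

    coproductRaw : RawComputon
    coproductRaw = record
      { U = L₁.U ⊎ L₂.U ; P = L₁.P ⊎ L₂.P ; I = L₁.I ⊎ L₂.I ; O = L₁.O ⊎ L₂.O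
      ; U-finite = finite-⊎ L₁.U-finite L₂.U-finite
      ; P-finite = finite-⊎ L₁.P-finite L₂.P-finite
      ; I-finite = finite-⊎ L₁.I-finite L₂.I-finite
      ; O-finite = finite-⊎ L₁.O-finite L₂.O-finite
      ; σ = Sum.map L₁.σ L₂.σ ; t = Sum.map L₁.t L₂.t
      ; τ = Sum.map L₁.τ L₂.τ ; s = Sum.map L₁.s L₂.s
      ; c = [ L₁.c , L₂.c ]′ ; r = Sum.map L₁.r L₂.r ; f = [ L₁.f , L₂.f ]′
      }

    private
      map-range : ∀ {X₁ X₂ Y₁ Y₂ : Set} {g₁ : X₁ → Y₁} {g₂ : X₂ → Y₂} →
                  (∀ y → y ∈ range g₁) → (∀ y → y ∈ range g₂) → ∀ y → y ∈ range (Sum.map g₁ g₂)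
      map-range h₁ h₂ (inj₁ y) = let x , eq = h₁ y in inj₁ x , cong inj₁ eq
      map-range h₁ h₂ (inj₂ y) = let x , eq = h₂ y in inj₂ x , cong inj₂ eq

      map-range-inj₁ : ∀ {X₁ X₂ Y₁ Y₂ : Set} {g₁ : X₁ → Y₁} {g₂ : X₂ → Y₂} {y} →
                       inj₁ y ∈ range (Sum.map g₁ g₂) → y ∈ range g₁
      map-range-inj₁ (inj₁ x , eq) = x , inj₁-injective eq

    infixr 5 _+ᶜ_
    _+ᶜ_ : Computon
    _+ᶜ_ = record { raw = coproductRaw ; isComputon = record
      { P-nonempty   = inj₁ L₁.P-nonempty
      ; f∈𝓑          = [ L₁.f∈𝓑 , L₂.f∈𝓑 ]
      ; σ-surjective = map-range L₁.σ-surjective L₂.σ-surjective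
      ; τ-surjective = map-range L₁.τ-surjective L₂.τ-surjective
      ; r-surjective = map-range L₁.r-surjective L₂.r-surjective
      ; τ-control-surjective = λ where
          (inj₁ u) → let i , ctl , eq = L₁.τ-control-surjective u in inj₁ i , ctl , cong inj₁ eq
          (inj₂ u) → let i , ctl , eq = L₂.τ-control-surjective u in inj₂ i , ctl , cong inj₂ eq
      ; σ-control-surjective = λ where
          (inj₁ u) → let o , ctl , eq = L₁.σ-control-surjective u in inj₁ o , ctl , cong inj₁ eq
          (inj₂ u) → let o , ctl , eq = L₂.σ-control-surjective u in inj₂ o , ctl , cong inj₂ eq
      ; σ∘r≗τ = [ cong inj₁ ∘ L₁.σ∘r≗τ , cong inj₂ ∘ L₂.σ∘r≗τ ]
      ; control-inport  = let p , p∈ , ctl = L₁.control-inport in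
                          inj₁ p , p∈ ∘ map-range-inj₁ , ctl
      ; control-outport = let p , p∈ , ctl = L₁.control-outport in
                          inj₁ p , p∈ ∘ map-range-inj₁ , ctl
      } }

  copairing : ∀ {L₁ L₂ L} → Morphism L₁ L → Morphism L₂ L → Morphism (L₁ +ᶜ L₂) L
  copairing {L₁} {L₂} {L} α β = record
    { mapU = [ α.mapU , β.mapU ]′ ; mapP = [ α.mapP , β.mapP ]′
    ; mapI = [ α.mapI , β.mapI ]′ ; mapO = [ α.mapO , β.mapO ]′
    ; map-τ = [ α.map-τ , β.map-τ ] ; map-σ = [ α.map-σ , β.map-σ ]
    ; map-s = [ α.map-s , β.map-s ] ; map-t = [ α.map-t , β.map-t ]
    ; map-r = [ α.map-r , β.map-r ]
    ; map-f = [ α.map-f , β.map-f ] ; map-c = [ α.map-c , β.map-c ]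
    ; boundary = λ {p} → bd p
    }
    where
    module α = Morphism α
    module β = Morphism β
    module L₁ = Computon L₁
    module L₂ = Computon L₂
    module S = Computon (L₁ +ᶜ L₂)

    P±₁ : ∀ {p} → p ∈ L₁.P⁺ ∪ L₁.P⁻ → inj₁ p ∈ S.P⁺ ∪ S.P⁻
    P±₁ (inj₁ h) = inj₁ λ { (inj₁ o , eq) → h (o , inj₁-injective eq) }
    P±₁ (inj₂ h) = inj₂ λ { (inj₁ o , eq) → h (o , inj₁-injective eq) }

    P±₂ : ∀ {p} → p ∈ L₂.P⁺ ∪ L₂.P⁻ → inj₂ p ∈ S.P⁺ ∪ S.P⁻
    P±₂ (inj₁ h) = inj₁ λ { (inj₂ o , eq) → h (o , inj₂-injective eq) }
    P±₂ (inj₂ h) = inj₂ λ { (inj₂ o , eq) → h (o , inj₂-injective eq) }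

    bd : ∀ p → _ → p ∈ S.P⁺ ∪ S.P⁻
    bd (inj₁ p) (inj₁ (u , u∈ , u∉)) = P±₁ (α.boundary (inj₁ (u , u∈ ,
      λ { (v , (o , eq , eq′) , e) → u∉ (inj₁ v , (inj₁ o , cong inj₁ eq , cong inj₁ eq′) , e) })))
    bd (inj₁ p) (inj₂ (u , u∈ , u∉)) = P±₁ (α.boundary (inj₂ (u , u∈ ,
      λ { (v , (o , eq , eq′) , e) → u∉ (inj₁ v , (inj₁ o , cong inj₁ eq , cong inj₁ eq′) , e) })))
    bd (inj₂ p) (inj₁ (u , u∈ , u∉)) = P±₂ (β.boundary (inj₁ (u , u∈ ,
      λ { (v , (o , eq , eq′) , e) → u∉ (inj₂ v , (inj₂ o , cong inj₂ eq , cong inj₂ eq′) , e) })))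
    bd (inj₂ p) (inj₂ (u , u∈ , u∉)) = P±₂ (β.boundary (inj₂ (u , u∈ ,
      λ { (v , (o , eq , eq′) , e) → u∉ (inj₂ v , (inj₂ o , cong inj₂ eq , cong inj₂ eq′) , e) })))

  module ComponentwisePushout {L₀ L₁ L₂ : Computon} (α : Morphism L₀ L₁) (β : Morphism L₀ L₂) where
    private
      module L₀ = Computon L₀
      module L₁ = Computon L₁
      module L₂ = Computon L₂
      module α = Morphism α
      module β = Morphism β

    module PU = Pushout (pushout L₀.U-finite L₁.U-finite L₂.U-finite α.mapU β.mapU)
    module PP = Pushout (pushout L₀.P-finite L₁.P-finite L₂.P-finite α.mapP β.mapP)
    module PI = Pushout (pushout L₀.I-finite L₁.I-finite L₂.I-finite α.mapI β.mapI)
    module PO = Pushout (pushout L₀.O-finite L₁.O-finite L₂.O-finite α.mapO β.mapO)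

    private
      σ-compat : ∀ o → PU.inl (L₁.σ (α.mapO o)) ≡ PU.inr (L₂.σ (β.mapO o))
      σ-compat o = trans (cong PU.inl (sym (α.map-σ o)))
                         (trans (PU.commutes _) (cong PU.inr (β.map-σ o)))

      t-compat : ∀ o → PP.inl (L₁.t (α.mapO o)) ≡ PP.inr (L₂.t (β.mapO o))
      t-compat o = trans (cong PP.inl (sym (α.map-t o)))
                         (trans (PP.commutes _) (cong PP.inr (β.map-t o)))

      τ-compat : ∀ i → PU.inl (L₁.τ (α.mapI i)) ≡ PU.inr (L₂.τ (β.mapI i))
      τ-compat i = trans (cong PU.inl (sym (α.map-τ i)))
                         (trans (PU.commutes _) (cong PU.inr (β.map-τ i)))

      s-compat : ∀ i → PP.inl (L₁.s (α.mapI i)) ≡ PP.inr (L₂.s (β.mapI i))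
      s-compat i = trans (cong PP.inl (sym (α.map-s i)))
                         (trans (PP.commutes _) (cong PP.inr (β.map-s i)))

      r-compat : ∀ i → PO.inl (L₁.r (α.mapI i)) ≡ PO.inr (L₂.r (β.mapI i))
      r-compat i = trans (cong PO.inl (sym (α.map-r i)))
                         (trans (PO.commutes _) (cong PO.inr (β.map-r i)))

      c-compat : ∀ p → L₁.c (α.mapP p) ≡ L₂.c (β.mapP p)
      c-compat p = trans (α.map-c p) (sym (β.map-c p))

      f-compat : ∀ o → L₁.f (α.mapO o) ≡ L₂.f (β.mapO o)
      f-compat o = trans (α.map-f o) (sym (β.map-f o))

    pushoutRaw : RawComputon
    pushoutRaw = record
      { U = PU.Carrier ; P = PP.Carrier ; I = PI.Carrier ; O = PO.Carrier
      ; U-finite = PU.finite ; P-finite = PP.finite ; I-finite = PI.finite ; O-finite = PO.finite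
      ; σ = PO.copair (PU.inl ∘ L₁.σ) (PU.inr ∘ L₂.σ) σ-compat
      ; t = PO.copair (PP.inl ∘ L₁.t) (PP.inr ∘ L₂.t) t-compat
      ; τ = PI.copair (PU.inl ∘ L₁.τ) (PU.inr ∘ L₂.τ) τ-compat
      ; s = PI.copair (PP.inl ∘ L₁.s) (PP.inr ∘ L₂.s) s-compat
      ; c = PP.copair L₁.c L₂.c c-compat
      ; r = PI.copair (PO.inl ∘ L₁.r) (PO.inr ∘ L₂.r) r-compat
      ; f = PO.copair L₁.f L₂.f f-compat
      }

    private module Q = RawComputon pushoutRaw

    σ-inl : ∀ o → Q.σ (PO.inl o) ≡ PU.inl (L₁.σ o)
    σ-inl = PO.copair-inl _ _ σ-compat
    σ-inr : ∀ o → Q.σ (PO.inr o) ≡ PU.inr (L₂.σ o)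
    σ-inr = PO.copair-inr _ _ σ-compat
    t-inl : ∀ o → Q.t (PO.inl o) ≡ PP.inl (L₁.t o)
    t-inl = PO.copair-inl _ _ t-compat
    t-inr : ∀ o → Q.t (PO.inr o) ≡ PP.inr (L₂.t o)
    t-inr = PO.copair-inr _ _ t-compat
    τ-inl : ∀ i → Q.τ (PI.inl i) ≡ PU.inl (L₁.τ i)
    τ-inl = PI.copair-inl _ _ τ-compat
    τ-inr : ∀ i → Q.τ (PI.inr i) ≡ PU.inr (L₂.τ i)
    τ-inr = PI.copair-inr _ _ τ-compat
    s-inl : ∀ i → Q.s (PI.inl i) ≡ PP.inl (L₁.s i)
    s-inl = PI.copair-inl _ _ s-compat
    s-inr : ∀ i → Q.s (PI.inr i) ≡ PP.inr (L₂.s i)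
    s-inr = PI.copair-inr _ _ s-compat
    r-inl : ∀ i → Q.r (PI.inl i) ≡ PO.inl (L₁.r i)
    r-inl = PI.copair-inl _ _ r-compat
    r-inr : ∀ i → Q.r (PI.inr i) ≡ PO.inr (L₂.r i)
    r-inr = PI.copair-inr _ _ r-compat
    c-inl : ∀ p → Q.c (PP.inl p) ≡ L₁.c p
    c-inl = PP.copair-inl _ _ c-compat
    c-inr : ∀ p → Q.c (PP.inr p) ≡ L₂.c p
    c-inr = PP.copair-inr _ _ c-compat
    f-inl : ∀ o → Q.f (PO.inl o) ≡ L₁.f o
    f-inl = PO.copair-inl _ _ f-compat
    f-inr : ∀ o → Q.f (PO.inr o) ≡ L₂.f o
    f-inr = PO.copair-inr _ _ f-compat

    control-inl : ∀ {p} → p ∈ L₁.Control → PP.inl p ∈ Q.Control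
    control-inl ctl = trans (cong toℕ (c-inl _)) ctl
    control-inr : ∀ {p} → p ∈ L₂.Control → PP.inr p ∈ Q.Control
    control-inr ctl = trans (cong toℕ (c-inr _)) ctl

    -- The remaining axiom, the existence of control inports and outports, can fail for
    -- arbitrary spans.
    pushout-isComputon : (∃ λ p → p ∈ Q.P⁺ × p ∈ Q.Control) → (∃ λ q → q ∈ Q.P⁻ × q ∈ Q.Control) →
                         IsComputon pushoutRaw
    pushout-isComputon inport outport = record
      { P-nonempty           = PP.inl L₁.P-nonempty
      ; f∈𝓑                  = f∈
      ; σ-surjective         = λ u → let o , _ , eq = σ-ctl u in o , eq
      ; τ-surjective         = λ u → let i , _ , eq = τ-ctl u in i , eq
      ; r-surjective         = r-surj
      ; τ-control-surjective = τ-ctl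
      ; σ-control-surjective = σ-ctl
      ; σ∘r≗τ                = σr
      ; control-inport       = inport
      ; control-outport      = outport
      }
      where
      f∈ : ∀ o → Q.f o ∈ˡ 𝓑
      f∈ o with PO.cover o
      ... | inj₁ (o′ , refl) = subst (_∈ˡ 𝓑) (sym (f-inl o′)) (L₁.f∈𝓑 o′)
      ... | inj₂ (o′ , refl) = subst (_∈ˡ 𝓑) (sym (f-inr o′)) (L₂.f∈𝓑 o′)

      r-surj : ∀ o → o ∈ range Q.r
      r-surj o with PO.cover o
      ... | inj₁ (o′ , refl) = let i , eq = L₁.r-surjective o′ in
                               PI.inl i , trans (r-inl i) (cong PO.inl eq)
      ... | inj₂ (o′ , refl) = let i , eq = L₂.r-surjective o′ in
                               PI.inr i , trans (r-inr i) (cong PO.inr eq)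

      τ-ctl : ∀ u → u ∈ image Q.τ (λ i → Q.s i ∈ Q.Control)
      τ-ctl u with PU.cover u
      ... | inj₁ (v , refl) = let i , ctl , eq = L₁.τ-control-surjective v in
        PI.inl i , subst Q.Control (sym (s-inl i)) (control-inl ctl)
                 , trans (τ-inl i) (cong PU.inl eq)
      ... | inj₂ (v , refl) = let i , ctl , eq = L₂.τ-control-surjective v in
        PI.inr i , subst Q.Control (sym (s-inr i)) (control-inr ctl)
                 , trans (τ-inr i) (cong PU.inr eq)

      σ-ctl : ∀ u → u ∈ image Q.σ (λ o → Q.t o ∈ Q.Control)
      σ-ctl u with PU.cover u
      ... | inj₁ (v , refl) = let o , ctl , eq = L₁.σ-control-surjective v in
        PO.inl o , subst Q.Control (sym (t-inl o)) (control-inl ctl)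
                 , trans (σ-inl o) (cong PU.inl eq)
      ... | inj₂ (v , refl) = let o , ctl , eq = L₂.σ-control-surjective v in
        PO.inr o , subst Q.Control (sym (t-inr o)) (control-inr ctl)
                 , trans (σ-inr o) (cong PU.inr eq)

      σr : Q.σ ∘ Q.r ≗ Q.τ
      σr i with PI.cover i
      ... | inj₁ (j , refl) = trans (cong Q.σ (r-inl j)) (trans (σ-inl (L₁.r j))
                                (trans (cong PU.inl (L₁.σ∘r≗τ j)) (sym (τ-inl j))))
      ... | inj₂ (j , refl) = trans (cong Q.σ (r-inr j)) (trans (σ-inr (L₂.r j))
                                (trans (cong PU.inr (L₂.σ∘r≗τ j)) (sym (τ-inr j))))

  record BDiagram (L₂ L₃ : Computon) : Set₁ where
    field
      L₀ L₁      : Computon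
      in₂        : InMarker L₀ L₂
      in₃        : InMarker L₀ L₃
      out₂       : OutMarker L₁ L₂
      out₃       : OutMarker L₁ L₃
      connected₂ : Connected L₂
      connected₃ : Connected L₃

  private
    first-edge : ∀ L {v w m} → Graph.Path L v w m → 2 ≤ m → v ∈ range (Graph.source L)
    first-edge L (e Graph.∷ _) _ = e , refl

    connected⇒disjoint : ∀ L → Connected L → ∀ {p} → p ∈ Computon.P⁺ L → p ∉ Computon.P⁻ L
    connected⇒disjoint L conn {p} p∈P⁺ p∈P⁻ with conn p (inj₁ p∈P⁺)
    ... | _ , _ , _ , 2≤m , path with first-edge L path 2≤m
    ... | inj₁ i , eq = p∈P⁻ (i , inj₂-injective eq)

  module _ {L₂ L₃ : Computon} (ρ : BDiagram L₂ L₃) where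
    open BDiagram ρ
    private
      module L₂   = Computon L₂
      module L₃   = Computon L₃
      module in₂  = InMarker in₂
      module in₃  = InMarker in₃
      module out₂ = OutMarker out₂
      module out₃ = OutMarker out₃

    leg₂ : Morphism (L₀ +ᶜ L₁) L₂
    leg₂ = copairing in₂.morphism out₂.morphism

    leg₃ : Morphism (L₀ +ᶜ L₁) L₃
    leg₃ = copairing in₃.morphism out₃.morphism

    open ComponentwisePushout leg₂ leg₃

    private
      module Q = RawComputon pushoutRaw

      inport? : ∀ L (p : Computon.P L) → Dec (p ∈ Computon.P⁺ L)
      inport? L p = ¬? (finite-∃? O-finite λ o → finite-≟ P-finite (t o) p)
        where open Computon L

      outport? : ∀ L (p : Computon.P L) → Dec (p ∈ Computon.P⁻ L)
      outport? L p = ¬? (finite-∃? I-finite λ i → finite-≟ P-finite (s i) p)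
        where open Computon L

      true≢false : true ≢ false
      true≢false ()

      -- The indicators of P⁺ and P⁻ on L₂ and L₃ agree along the span, since P⁺ and P⁻ are
      -- disjoint in a connected computon; hence they descend to the pushout.
      isInport-compat : ∀ x → does (inport? L₂ (Morphism.mapP leg₂ x)) ≡ does (inport? L₃ (Morphism.mapP leg₃ x))
      isInport-compat (inj₁ x) =
        trans (dec-true (inport? L₂ _) (proj₁ in₂.image-P (x , refl)))
         (sym (dec-true (inport? L₃ _) (proj₁ in₃.image-P (x , refl))))
      isInport-compat (inj₂ x) =
        trans (dec-false (inport? L₂ _)
                (λ p → connected⇒disjoint L₂ connected₂ p (proj₁ out₂.image-P (x , refl))))
         (sym (dec-false (inport? L₃ _)
                (λ p → connected⇒disjoint L₃ connected₃ p (proj₁ out₃.image-P (x , refl)))))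

      isInport : Q.P → Bool
      isInport = PP.copair (does ∘ inport? L₂) (does ∘ inport? L₃) isInport-compat

      isInport-inl : ∀ p → isInport (PP.inl p) ≡ does (inport? L₂ p)
      isInport-inl = PP.copair-inl _ _ isInport-compat

      isInport-inr : ∀ p → isInport (PP.inr p) ≡ does (inport? L₃ p)
      isInport-inr = PP.copair-inr _ _ isInport-compat

      isOutport-compat : ∀ x → does (outport? L₂ (Morphism.mapP leg₂ x)) ≡ does (outport? L₃ (Morphism.mapP leg₃ x))
      isOutport-compat (inj₁ x) =
        trans (dec-false (outport? L₂ _)
                (connected⇒disjoint L₂ connected₂ (proj₁ in₂.image-P (x , refl))))
         (sym (dec-false (outport? L₃ _)
                (connected⇒disjoint L₃ connected₃ (proj₁ in₃.image-P (x , refl)))))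
      isOutport-compat (inj₂ x) =
        trans (dec-true (outport? L₂ _) (proj₁ out₂.image-P (x , refl)))
         (sym (dec-true (outport? L₃ _) (proj₁ out₃.image-P (x , refl))))

      isOutport : Q.P → Bool
      isOutport = PP.copair (does ∘ outport? L₂) (does ∘ outport? L₃) isOutport-compat

      isOutport-inl : ∀ p → isOutport (PP.inl p) ≡ does (outport? L₂ p)
      isOutport-inl = PP.copair-inl _ _ isOutport-compat

      isOutport-inr : ∀ p → isOutport (PP.inr p) ≡ does (outport? L₃ p)
      isOutport-inr = PP.copair-inr _ _ isOutport-compat

      isInport-t : ∀ o → isInport (Q.t o) ≡ false
      isInport-t o with PO.cover o
      ... | inj₁ (o′ , refl) = trans (cong isInport (t-inl o′)) (trans (isInport-inl _)
                                 (dec-false (inport? L₂ _) (λ h → h (o′ , refl))))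
      ... | inj₂ (o′ , refl) = trans (cong isInport (t-inr o′)) (trans (isInport-inr _)
                                 (dec-false (inport? L₃ _) (λ h → h (o′ , refl))))

      isOutport-s : ∀ i → isOutport (Q.s i) ≡ false
      isOutport-s i with PI.cover i
      ... | inj₁ (i′ , refl) = trans (cong isOutport (s-inl i′)) (trans (isOutport-inl _)
                                 (dec-false (outport? L₂ _) (λ h → h (i′ , refl))))
      ... | inj₂ (i′ , refl) = trans (cong isOutport (s-inr i′)) (trans (isOutport-inr _)
                                 (dec-false (outport? L₃ _) (λ h → h (i′ , refl))))

      control-inport : ∃ λ p → p ∈ Q.P⁺ × p ∈ Q.Control
      control-inport = let p , p∈ , ctl = L₂.control-inport in
        PP.inl p
        , (λ (o , eq) → true≢false (trans
             (sym (trans (isInport-inl p) (dec-true (inport? L₂ p) p∈)))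
             (trans (cong isInport (sym eq)) (isInport-t o))))
        , control-inl ctl

      control-outport : ∃ λ p → p ∈ Q.P⁻ × p ∈ Q.Control
      control-outport = let p , p∈ , ctl = L₂.control-outport in
        PP.inl p
        , (λ (i , eq) → true≢false (trans
             (sym (trans (isOutport-inl p) (dec-true (outport? L₂ p) p∈)))
             (trans (cong isOutport (sym eq)) (isOutport-s i))))
        , control-inl ctl

    closedBranching : Computon
    closedBranching = record
      { raw = pushoutRaw ; isComputon = pushout-isComputon control-inport control-outport }

-- Pair L with itself along its full in- and out-markers. The apexes are trivial, so the pushout has
-- units U ⊎ U; an isomorphism with L would embed U ⊎ U into the finite set U, forcing U to be empty,
-- while connectedness provides an edge leaving the control inport, hence a unit.
module Submission where

open import Data.Empty using (⊥-elim)
open import Data.Fin using (Fin; zero; suc)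
open import Data.Fin.Properties using (injective⇒≤)
open import Data.List using (List; allFin; filter; length; lookup)
open import Data.List.Membership.Propositional using (_∈_)
open import Data.List.Membership.Propositional.Properties
  using (∈-allFin; ∈-filter⁺; ∈-filter⁻; ∈-lookup)
open import Data.List.Relation.Unary.All as All using ()
open import Data.List.Relation.Unary.AllPairs using (_∷_)
open import Data.List.Relation.Unary.Any using (index)
open import Data.List.Relation.Unary.Any.Properties using (lookup-index)
open import Data.List.Relation.Unary.Unique.Propositional using (Unique)
open import Data.List.Relation.Unary.Unique.Propositional.Properties
  using (allFin⁺; filter⁺)
open import Data.Nat using (ℕ; suc; _+_; _≤_)
open import Data.Nat.Properties using (m+n≮n)
open import Data.Product using (∃; _×_; _,_; proj₁; proj₂)
open import Data.Sum using (_⊎_; inj₁; inj₂; [_,_]; [_,_]′)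
open import Function using (_∘_; _↔_; Inverse; Injection)
open import Function.Construct.Identity using (↔-id)
open import Function.Construct.Symmetry using (↔-sym)
open import Function.Definitions using (Injective)
open import Function.Properties.Inverse using (↔⇒↣)
open import Level using (0ℓ)
open import Relation.Binary.PropositionalEquality using (_≡_; refl; sym; trans; cong; subst)
open import Relation.Nullary using (¬_; ¬?; contradiction)
open import Relation.Unary using (Pred; Decidable; _≐_)
open import Defs

private variable
  A B : Set

lookup-injective : {xs : List A} → Unique xs → Injective _≡_ _≡_ (lookup xs)
lookup-injective (_  ∷ _)   {zero}  {zero}  _  = refl
lookup-injective (x∉ ∷ _)   {zero}  {suc j} eq = contradiction eq (All.lookup x∉ (∈-lookup j))
lookup-injective (x∉ ∷ _)   {suc i} {zero}  eq = contradiction (sym eq) (All.lookup x∉ (∈-lookup i))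
lookup-injective (_  ∷ xs!) {suc i} {suc j} eq = cong suc (lookup-injective xs! eq)

range? : Finite A → Finite B → (g : A → B) → Decidable (range g)
range? finA finB g b = finite-∃? finA λ a → finite-≟ finB (g a) b

-- Supplies the ports of a marker's apex: these must form a finite set of their own, mapped
-- injectively onto `P⁺` or `P⁻`. The indices in `Fin n` are filtered, since `allFin n` is already
-- duplicate-free, and `from` carries distinctness over to `A`.
enumerate : {Q : Pred A 0ℓ} → Finite A → Decidable Q →
            ∃ λ k → ∃ λ (g : Fin k → A) → Injective _≡_ _≡_ g × range g ≐ Q
enumerate {A} {Q} (n , α) Q? = length xs , g , g-injective , g∈Q , Q⊆range
  where
  open Inverse α
  Q∘from? : Decidable (Q ∘ from)
  Q∘from? i = Q? (from i)

  xs : List (Fin n)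
  xs = filter Q∘from? (allFin n)

  g : Fin (length xs) → A
  g i = from (lookup xs i)

  g-injective : Injective _≡_ _≡_ g
  g-injective eq = lookup-injective (filter⁺ Q∘from? (allFin⁺ n))
    (Injection.injective (↔⇒↣ (↔-sym α)) eq)

  g∈Q : ∀ {x} → range g x → Q x
  g∈Q (i , refl) = proj₂ (∈-filter⁻ Q∘from? {xs = allFin n} (∈-lookup i))

  Q⊆range : ∀ {x} → Q x → range g x
  Q⊆range {x} q = index x∈xs , trans (cong from (sym (lookup-index x∈xs))) (strictlyInverseʳ x)
    where
    x∈xs : to x ∈ xs
    x∈xs = ∈-filter⁺ Q∘from? (∈-allFin (to x)) (subst Q (sym (strictlyInverseʳ x)) q)

-- Counting: transported to `Fin`, `h` would give `k + k ≤ k`, while an element of `A` forces `k` to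
-- be positive.
no-doubling : Finite A → (h : A ⊎ A → A) → Injective _≡_ _≡_ h → ¬ A
no-doubling {A} (k , α) h h-injective a = absurd k (Inverse.to α a) (injective⇒≤ {f = e} e-injective)
  where
  α⊎α : (A ⊎ A) ↔ Fin (k + k)
  α⊎α = proj₂ (finite-⊎ (k , α) (k , α))

  e : Fin (k + k) → Fin k
  e = Inverse.to α ∘ h ∘ Inverse.from α⊎α

  e-injective : Injective _≡_ _≡_ e
  e-injective = Injection.injective (↔⇒↣ (↔-sym α⊎α)) ∘ h-injective ∘ Injection.injective (↔⇒↣ α)

  absurd : ∀ k → Fin k → ¬ (k + k ≤ k)
  -- By definition `suc k + suc k ≤ suc k` is `k + suc k < suc k`.
  absurd (suc k) _ = m+n≮n k (suc k)

module _ (n : ℕ) {𝓐 : Set} (𝓑 : List (List 𝓐)) where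
  open Computons n 𝓑

  -- Builds in-markers and out-markers uniformly. The control port in `Q` is what makes the edgeless
  -- apex a computon.
  module PortSubset (L : Computon) {Q : Pred (Computon.P L) 0ℓ} (Q? : Decidable Q)
                    (control : ∃ λ p → Q p × Computon.Control L p) where
    open Computon L

    private
      enumeration = enumerate P-finite Q?
      size = proj₁ enumeration
      port = proj₁ (proj₂ enumeration)

      port-injective : Injective _≡_ _≡_ port
      port-injective = proj₁ (proj₂ (proj₂ enumeration))

    range-port : range port ≐ Q
    range-port = proj₂ (proj₂ (proj₂ enumeration))

    private
      preimage : range port (proj₁ control)
      preimage = proj₂ range-port (proj₁ (proj₂ control))

      controlPort : ∃ λ i → Control (port i)
      controlPort = proj₁ preimage , subst Control (sym (proj₂ preimage)) (proj₂ (proj₂ control))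

    discrete : Computon
    discrete = record
      { raw = record
        { U = Fin 0 ; P = Fin size ; I = Fin 0 ; O = Fin 0
        ; U-finite = 0 , ↔-id _ ; P-finite = size , ↔-id _
        ; I-finite = 0 , ↔-id _ ; O-finite = 0 , ↔-id _
        ; σ = λ () ; t = λ () ; τ = λ () ; s = λ () ; c = c ∘ port ; r = λ () ; f = λ () }
      ; isComputon = record
        { P-nonempty = proj₁ controlPort ; f∈𝓑 = λ ()
        ; σ-surjective = λ () ; τ-surjective = λ () ; r-surjective = λ ()
        ; τ-control-surjective = λ () ; σ-control-surjective = λ () ; σ∘r≗τ = λ ()
        -- Without edges every port is both an inport and an outport, so one control port serves
        -- twice.
        ; control-inport  = proj₁ controlPort , (λ ()) , proj₂ controlPort
        ; control-outport = proj₁ controlPort , (λ ()) , proj₂ controlPort } }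

    discrete-trivial : Trivial discrete
    discrete-trivial = (λ ()) , (λ ()) , (λ ())

    inclusion : Morphism discrete L
    inclusion = record
      { mapU = λ () ; mapP = port ; mapI = λ () ; mapO = λ ()
      ; map-τ = λ () ; map-σ = λ () ; map-s = λ () ; map-t = λ () ; map-r = λ () ; map-f = λ ()
      -- Whatever is attached to the image of a port in `L`, the port itself is an inport of the
      -- edgeless source.
      ; map-c = λ _ → refl ; boundary = λ _ → inj₁ λ () }

    inclusion-mono : IsMono inclusion
    inclusion-mono = (λ { {()} }) , port-injective , (λ { {()} }) , (λ { {()} })

  module _ (L : Computon) where
    open Computon L

    private
      module In  = PortSubset L (¬? ∘ range? O-finite P-finite t) control-inport
      module Out = PortSubset L (¬? ∘ range? I-finite P-finite s) control-outport

    inMarker : InMarker In.discrete L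
    inMarker = record
      { trivial = In.discrete-trivial ; morphism = In.inclusion
      ; mono = In.inclusion-mono ; image-P = In.range-port }

    outMarker : OutMarker Out.discrete L
    outMarker = record
      { trivial = Out.discrete-trivial ; morphism = Out.inclusion
      ; mono = Out.inclusion-mono ; image-P = Out.range-port }

    -- Using the same marker on both sides makes the two legs of each span share their apex
    -- automatically.
    diagonal : Connected L → BDiagram L L
    diagonal connected = record
      { in₂ = inMarker ; in₃ = inMarker ; out₂ = outMarker ; out₃ = outMarker
      ; connected₂ = connected ; connected₃ = connected }

    -- Every edge of the bipartite graph has a unit at one end, and connectedness gives a nonempty
    -- path from the control inport.
    connected⇒unit : Connected L → U
    connected⇒unit connected with control-inport
    ... | p , p∈P⁺ , _ = let _ , _ , _ , 2≤m , path = connected p (inj₁ p∈P⁺) in first 2≤m path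
      where
      open Graph L
      -- The bound `2 ≤ m` excludes the empty path.
      first : ∀ {v w m} → 2 ≤ m → Path v w m → U
      first _ (inj₁ i ∷ _) = τ i
      first _ (inj₂ o ∷ _) = σ o

  -- The apexes have no units, so the pushout identifies none. As `pushout` is opaque, injectivity
  -- comes from its universal property: `copair` of the two injections is a left inverse.
  closedBranching-embeds-units :
    ∀ {L₂ L₃} (ρ : BDiagram L₂ L₃) →
    ∃ λ (h : Computon.U L₂ ⊎ Computon.U L₃ → Computon.U (closedBranching ρ)) → Injective _≡_ _≡_ h
  closedBranching-embeds-units {L₂} {L₃} ρ = h , λ {x} {y} eq →
    trans (sym (retract-h x)) (trans (cong retract eq) (retract-h y))
    where
    open BDiagram ρ
    open ComponentwisePushout (leg₂ ρ) (leg₃ ρ)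
    h : Computon.U L₂ ⊎ Computon.U L₃ → PU.Carrier
    h = [ PU.inl , PU.inr ]′

    no-glueing : ∀ u → inj₁ (Morphism.mapU (leg₂ ρ) u) ≡ inj₂ (Morphism.mapU (leg₃ ρ) u)
    no-glueing (inj₁ u) = ⊥-elim (proj₁ (InMarker.trivial in₂) u)
    no-glueing (inj₂ u) = ⊥-elim (proj₁ (OutMarker.trivial out₂) u)

    retract : PU.Carrier → Computon.U L₂ ⊎ Computon.U L₃
    retract = PU.copair inj₁ inj₂ no-glueing

    retract-h : ∀ x → retract (h x) ≡ x
    retract-h = [ PU.copair-inl inj₁ inj₂ no-glueing , PU.copair-inr inj₁ inj₂ no-glueing ]

  -- An isomorphism is injective on units by `from∘to-U`; after the embedding `h` it would squeeze
  -- two copies of the nonempty set of units into one.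
  closedBranching-self-≇ : ∀ {L} (ρ : BDiagram L L) → ¬ (closedBranching ρ ≅ L)
  closedBranching-self-≇ {L} ρ iso =
    no-doubling (Computon.U-finite L) (Morphism.mapU to ∘ h)
      (λ {x} {y} eq → h-injective (trans (sym (from∘to-U (h x)))
        (trans (cong (Morphism.mapU from) eq) (from∘to-U (h y)))))
      (connected⇒unit L (BDiagram.connected₂ ρ))
    where
    open _≅_ iso
    h = proj₁ (closedBranching-embeds-units ρ)
    h-injective : Injective _≡_ _≡_ h
    h-injective = proj₂ (closedBranching-embeds-units ρ)

theorem13 : (n : ℕ) → 1 ≤ n → (𝓐 : Set) → Finite 𝓐 →
    (𝓑 : List (List 𝓐)) (ε : List 𝓐) → ε ∈ 𝓑 →
    let open Computons n 𝓑 in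
    ¬ (∃ λ (L : Computon) → Connected L ×
        ((L₃ : Computon) → Connected L₃ →
          ((ρ : BDiagram L L₃) → closedBranching ρ ≅ L₃) ×
          ((ρ′ : BDiagram L₃ L) → closedBranching ρ′ ≅ L₃)))
theorem13 n _ _ _ 𝓑 _ _ (L , connected , identity) =
  -- The supposed identity `L` is tested against itself, that is, with `L` in the role of `L₃`.
  closedBranching-self-≇ n 𝓑 ρ (proj₁ (identity L connected) ρ)
  where
  ρ = diagonal n 𝓑 L connected
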